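{- For all positive integers $m\leqslant n$, the complete bipartite graph $K_{m,n}$ belongs to $B_{2m-2}^{m}$, i.e. $K_{m,n}$ has a monotonic $(2m-2)$-bend EPG representation. (In the symbol $B_{\ell}^{m}$ the superscript $m$ stands for "monotonic" and is not the integer $m$.)
   Context: All graphs are finite and simple. $K_{m,n}$ is the complete bipartite graph with partition classes of sizes $m$ and $n$. A grid consists of horizontal grid lines (rows, increasing from bottom to top) and vertical grid lines (columns, increasing from left to right). A grid point is a crossing of two grid lines. A grid edge is the part of a grid line between two consecutive grid points. A path on a grid consists of two grid points (its end points) and a number of consecutive grid edges connecting them. A bend of a path is a turn of the path at a grid point. An EPG representation of a graph $G$ assigns to each vertex $v$ of $G$ a path $P_v$ on a common grid such that two distinct vertices $v,w$ are adjacent in $G$ if and only if $P_v$ and $P_w$ share at least one grid edge. A path is monotonic if it is ascending in both columns and rows, i.e. it has the shape of a staircase going upwards from left to right. For a nonnegative integer $\ell$, $B_\ell^m$ (the superscript $m$ is just a symbol for "monotonic") is the class of all graphs that have an EPG representation in which every path is monotonic and has at most $\ell$ bends. -}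

module Defs where

open import Data.Bool using (if_then_else_)
open import Data.Empty using (⊥)
open import Data.Fin using (Fin)
open import Data.Fin.Properties using (+↔⊎)
open import Data.List using (List; []; _∷_; length)
open import Data.List.Relation.Unary.All using (All)
open import Data.List.Relation.Unary.Linked using (Linked)
open import Data.List.Relation.Unary.Unique.Propositional using (Unique)
open import Data.Nat using (ℕ; suc; _+_; _≤_; _<_; _≟_)
open import Data.Product using (Σ-syntax; ∃-syntax; _×_; _,_; proj₁; proj₂)
open import Data.Sum using (_⊎_; inj₁; inj₂)
open import Data.Unit using (⊤; tt)
open import Function using (flip; _↔_; _⇔_)
open import Function.Properties.Inverse using (↔-sym)
open import Relation.Binary.Construct.Closure.Symmetric using (SymClosure)
open import Relation.Binary.Definitions using (Irreflexive; Symmetric)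
open import Relation.Binary.PropositionalEquality using (_≡_; _≢_; refl)
open import Relation.Nullary using (Dec; does)
open import Relation.Nullary.Decidable using (_⊎-dec_)
open import Level using (0ℓ)
open import Relation.Unary using (Pred)

record FiniteSimpleGraph : Set₁ where
  field
    Vertex : Set
    finite : ∃[ k ] (Vertex ↔ Fin k)
    Adj    : Vertex → Vertex → Set
    sym    : Symmetric Adj
    irrefl : Irreflexive _≡_ Adj

open FiniteSimpleGraph public using (Vertex; Adj)

KAdj : ∀ {m n} → Fin m ⊎ Fin n → Fin m ⊎ Fin n → Set
KAdj (inj₁ _) (inj₁ _) = ⊥
KAdj (inj₁ _) (inj₂ _) = ⊤
KAdj (inj₂ _) (inj₁ _) = ⊤
KAdj (inj₂ _) (inj₂ _) = ⊥

KAdj-sym : ∀ {m n} → Symmetric (KAdj {m} {n})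
KAdj-sym {x = inj₁ _} {y = inj₂ _} _ = tt
KAdj-sym {x = inj₂ _} {y = inj₁ _} _ = tt

KAdj-irrefl : ∀ {m n} → Irreflexive _≡_ (KAdj {m} {n})
KAdj-irrefl {x = inj₁ _} refl ()
KAdj-irrefl {x = inj₂ _} refl ()

K : ℕ → ℕ → FiniteSimpleGraph
K m n = record
  { Vertex = Fin m ⊎ Fin n
  ; finite = m + n , ↔-sym +↔⊎
  ; Adj    = KAdj
  ; sym    = λ {u} {v} → KAdj-sym {x = u} {y = v}
  ; irrefl = λ {u} {v} → KAdj-irrefl {x = u} {y = v}
  }

-- Columns are numbered from left to right and rows from bottom to top,
-- both starting at 0.
record Grid : Set where
  field
    columns : ℕ
    rows    : ℕ

Point : Set
Point = ℕ × ℕ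

col row : Point → ℕ
col = proj₁
row = proj₂

_onGrid_ : Point → Grid → Set
p onGrid G = col p < Grid.columns G × row p < Grid.rows G

data Step : Point → Point → Set where
  right : ∀ {x y} → Step (x , y) (suc x , y)
  up    : ∀ {x y} → Step (x , y) (x , suc y)

-- A path is given by the grid points on it, listed from one end point to the
-- other.  Successive points span a grid edge, which may be traversed in any
-- of the four directions; a path has at least one edge and does not revisit
-- a grid point.
record Path (G : Grid) : Set where
  field
    points     : List Point
    inGrid     : All (_onGrid G) points
    connected  : Linked (SymClosure Step) points
    simple     : Unique points
    nontrivial : 2 ≤ length points

open Path public using (points)

OnCommonLine : Point → Point → Set
OnCommonLine p q = col p ≡ col q ⊎ row p ≡ row q

onCommonLine? : ∀ p q → Dec (OnCommonLine p q)
onCommonLine? p q = (col p ≟ col q) ⊎-dec (row p ≟ row q)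

-- As a path does not turn back on itself, it turns at an interior point q
-- exactly when the predecessor and the successor of q do not lie on a common
-- grid line.
bendsOf : List Point → ℕ
bendsOf (p ∷ q ∷ r ∷ ps) =
  (if does (onCommonLine? p r) then 0 else 1) + bendsOf (q ∷ r ∷ ps)
bendsOf _ = 0

bends : ∀ {G} → Path G → ℕ
bends P = bendsOf (points P)

-- The list of points carries an orientation which the path itself does not
-- have, hence the two cases.  A horizontal or vertical segment is monotonic.
Monotonic : ∀ {G} → Path G → Set
Monotonic P = Linked Step (points P) ⊎ Linked (flip Step) (points P)

data Consecutive (p q : Point) : List Point → Set where
  here  : ∀ {ps} → Consecutive p q (p ∷ q ∷ ps)
  there : ∀ {r ps} → Consecutive p q ps → Consecutive p q (r ∷ ps)

-- The grid edge between p and q, regarded as undirected, belongs to P.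
HasEdge : ∀ {G} → Path G → Point → Point → Set
HasEdge P p q = Consecutive p q (points P) ⊎ Consecutive q p (points P)

ShareEdge : ∀ {G} → Path G → Path G → Set
ShareEdge P Q = ∃[ p ] ∃[ q ] (HasEdge P p q × HasEdge Q p q)

record EPGRepresentation (Γ : FiniteSimpleGraph) : Set where
  field
    grid       : Grid
    path       : Vertex Γ → Path grid
    represents : ∀ {v w} → v ≢ w → Adj Γ v w ⇔ ShareEdge (path v) (path w)

-- The superscript stands for "monotonic"; it is not a parameter.
Bᵐ : ℕ → Pred FiniteSimpleGraph 0ℓ
Bᵐ ℓ Γ = Σ[ R ∈ EPGRepresentation Γ ]
  (∀ v → let P = EPGRepresentation.path R v in Monotonic P × bends P ≤ ℓ)

{-# OPTIONS --safe #-}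
-- The m-side consists of the full rows 0, …, m − 1.  The j-th path of the
-- n-side is the staircase (j,0) → (j+1,0) → (j+1,1) → … → (j+m,m−1) along a
-- diagonal: it has one edge in each row, hence m − 1 vertical edges and 2m − 2
-- bends, and any edge of it determines the diagonal and so j.
module Submission where

open import Defs
open import Data.Bool using (true; false)
open import Data.Fin using (Fin; toℕ)
open import Data.Fin.Properties using (toℕ<n; toℕ-injective)
open import Data.List using (List; []; _∷_; applyUpTo; length)
open import Data.List.Relation.Unary.All using (All; []; _∷_)
open import Data.List.Relation.Unary.All.Properties using (applyUpTo⁺₁; applyUpTo⁺₂)
import Data.List.Relation.Unary.AllPairs as AllPairs
open import Data.List.Relation.Unary.Linked as Linked using (Linked; [-]; _∷_)
import Data.List.Relation.Unary.Linked.Properties as Linkedₚ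
open import Data.List.Relation.Unary.Unique.Propositional using (Unique)
open import Data.Nat using (ℕ; zero; suc; _+_; _*_; _∸_; _≤_; _<_; z≤n; s≤s; s<s)
open import Data.Nat.Properties
open import Data.Product using (∃-syntax; _×_; _,_)
open import Data.Sum using (inj₁; inj₂)
open import Data.Unit using (tt)
open import Function using (_⇔_; mk⇔; _on_)
import Relation.Binary.Construct.Closure.Symmetric as Sym
open import Relation.Binary.PropositionalEquality
  using (_≡_; _≢_; refl; sym; trans; cong; subst)
open import Relation.Nullary using (¬_; does; contradiction)
open import Relation.Nullary.Decidable using (dec-true)
open import Relation.Unary using (_∈_)

private variable
  p q : Point
  ps : List Point
  f : ℕ → Point
  G : Grid

-- Every `Step` raises this sum, so it is a strict potential along ascending lists: it excludes both
-- opposite traversals of an edge and repeated points.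
height : Point → ℕ
height p = col p + row p

step-height : Step p q → height p < height q
step-height right        = n<1+n _
step-height (up {x} {y}) = +-monoʳ-< x (n<1+n y)

step-asym : Step p q → ¬ Step q p
step-asym s t = <-asym (step-height s) (step-height t)

-- `Linked` speaks of neighbours only; transitivity of `<` on heights carries the comparison to all
-- pairs, and points of different height are distinct.
ascending⇒unique : Linked Step ps → Unique ps
ascending⇒unique ss =
  AllPairs.map (λ { h<h refl → <-irrefl refl h<h })
    (Linkedₚ.Linked⇒AllPairs {R = _<_ on height} <-trans (Linked.map step-height ss))

consecutive⇒related : ∀ {R : Point → Point → Set} →
                      Linked R ps → Consecutive p q ps → R p q
consecutive⇒related (r ∷ _)  here      = r
consecutive⇒related (_ ∷ rs) (there c) = consecutive⇒related rs c

consecutive⇒All : ∀ {P : Point → Set} → All P ps → Consecutive p q ps → P p × P q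
consecutive⇒All (px ∷ py ∷ _) here      = px , py
consecutive⇒All (_ ∷ pxs)     (there c) = consecutive⇒All pxs c

consecutive-applyUpTo : ∀ i n → suc i < n →
                        Consecutive (f i) (f (suc i)) (applyUpTo f n)
consecutive-applyUpTo zero    (suc (suc n)) _         = here
consecutive-applyUpTo zero    (suc zero)    (s<s ())
consecutive-applyUpTo (suc i) (suc n)       (s<s i<n) = there (consecutive-applyUpTo i n i<n)

-- `HasEdge` forgets orientation. Two ascending lists must traverse a common edge in the same
-- direction, since opposite directions would contradict `step-asym`; so two of the four cases
-- vanish.
shareEdge⇒consecutive :
  (P Q : Path G) → Linked Step (points P) → Linked Step (points Q) → ShareEdge P Q →
  ∃[ p ] ∃[ q ] (Consecutive p q (points P) × Consecutive p q (points Q))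
shareEdge⇒consecutive _ _ _ _ (p , q , inj₁ c , inj₁ d) = p , q , c , d
shareEdge⇒consecutive _ _ _ _ (p , q , inj₂ c , inj₂ d) = q , p , c , d
shareEdge⇒consecutive _ _ l k (_ , _ , inj₁ c , inj₂ d) =
  contradiction (consecutive⇒related k d) (step-asym (consecutive⇒related l c))
shareEdge⇒consecutive _ _ l k (_ , _ , inj₂ c , inj₁ d) =
  contradiction (consecutive⇒related k d) (step-asym (consecutive⇒related l c))

-- A new first point creates at most one new triple of successive points.
bendsOf-∷ : ∀ p ps → bendsOf (p ∷ ps) ≤ suc (bendsOf ps)
bendsOf-∷ p []           = z≤n
bendsOf-∷ p (q ∷ [])     = z≤n
bendsOf-∷ p (q ∷ r ∷ ps) with does (onCommonLine? p r)
... | true  = n≤1+n _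
... | false = ≤-refl

bendsOf-straight : ∀ p q r ps → OnCommonLine p r →
                   bendsOf (p ∷ q ∷ r ∷ ps) ≡ bendsOf (q ∷ r ∷ ps)
bendsOf-straight p q r ps p~r rewrite dec-true (onCommonLine? p r) p~r = refl

bendsOf-inRow : ∀ {y} ps → All (λ p → row p ≡ y) ps → bendsOf ps ≡ 0
bendsOf-inRow []               _ = refl
bendsOf-inRow (p ∷ [])         _ = refl
bendsOf-inRow (p ∷ q ∷ [])     _ = refl
bendsOf-inRow (p ∷ q ∷ r ∷ ps) (p∈y ∷ q∈y ∷ r∈y ∷ ps∈y) =
  trans (bendsOf-straight p q r ps (inj₂ (trans p∈y (sym r∈y))))
        (bendsOf-inRow (q ∷ r ∷ ps) (q∈y ∷ r∈y ∷ ps∈y))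

rowPoints : ℕ → ℕ → List Point
rowPoints y = applyUpTo (_, y)

rowPoints-row : ∀ y n → All (λ p → row p ≡ y) (rowPoints y n)
rowPoints-row y n = applyUpTo⁺₂ (_, y) n (λ _ → refl)

rowPoints-ascending : ∀ y n → Linked Step (rowPoints y n)
rowPoints-ascending y n = Linkedₚ.applyUpTo⁺₂ (_, y) n (λ _ → right)

-- The starting point is split off so that `stair x y k` is visibly a cons for a variable `k`, as
-- the `Linked` and `Consecutive` constructors require. Here `k` counts the vertical edges, and the
-- last edge is horizontal.
stairTail : ℕ → ℕ → ℕ → List Point
stairTail x y zero    = (suc x , y) ∷ []
stairTail x y (suc k) = (suc x , y) ∷ (suc x , suc y) ∷ stairTail (suc x) (suc y) k

stair : ℕ → ℕ → ℕ → List Point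
stair x y k = (x , y) ∷ stairTail x y k

stair-nontrivial : ∀ x y k → 2 ≤ length (stair x y k)
stair-nontrivial x y zero    = ≤-refl
stair-nontrivial x y (suc k) = s≤s (s≤s z≤n)

stair-ascending : ∀ x y k → Linked Step (stair x y k)
stair-ascending x y zero    = right ∷ [-]
stair-ascending x y (suc k) = right ∷ up ∷ stair-ascending (suc x) (suc y) k

-- The two bounds concern the final point `(x + suc k , y + k)`, which is extreme in both
-- coordinates.
stair-onGrid : ∀ x y k → x + suc k < Grid.columns G → y + k < Grid.rows G →
               All (_onGrid G) (stair x y k)
stair-onGrid {G} x y zero x< y< =
    (m+n≤o⇒m≤o (suc x) x< , m+n≤o⇒m≤o (suc y) y<)
  ∷ (subst (_< Grid.columns G) (+-comm x 1) x< , m+n≤o⇒m≤o (suc y) y<)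
  ∷ []
stair-onGrid {G} x y (suc k) x< y<
  -- The head of the recursive result is the corner `(suc x , suc y)`; its bounds also cover the two
  -- points before it.
  with (sx< , sy<) ∷ rest ← stair-onGrid {G} (suc x) (suc y) k
         (subst (_< Grid.columns G) (+-suc x (suc k)) x<)
         (subst (_< Grid.rows G) (+-suc y k) y<) =
  (<-trans (n<1+n x) sx< , <-trans (n<1+n y) sy<) ∷
  (sx< , <-trans (n<1+n y) sy<) ∷ (sx< , sy<) ∷ rest

-- Each further stair prepends two points, each costing at most one bend.
stair-bends : ∀ x y k → bendsOf (stair x y k) ≤ 2 * k
stair-bends x y zero    = z≤n
stair-bends x y (suc k) = begin
  bendsOf (stair x y (suc k))                         ≤⟨ bendsOf-∷ (x , y) ((suc x , y) ∷ stair (suc x) (suc y) k) ⟩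
  1 + bendsOf ((suc x , y) ∷ stair (suc x) (suc y) k) ≤⟨ s≤s (bendsOf-∷ (suc x , y) (stair (suc x) (suc y) k)) ⟩
  2 + bendsOf (stair (suc x) (suc y) k)               ≤⟨ s≤s (s≤s (stair-bends (suc x) (suc y) k)) ⟩
  2 + 2 * k                                           ≡⟨ *-suc 2 k ⟨
  2 * suc k                                           ∎
  where open ≤-Reasoning

stair-edgeInRow : ∀ x y k i → i ≤ k →
  Consecutive (i + x , i + y) (suc (i + x) , i + y) (stair x y k)
stair-edgeInRow x y zero    zero    _         = here
stair-edgeInRow x y (suc k) zero    _         = here
stair-edgeInRow x y (suc k) (suc i) (s≤s i≤k)
  -- Moves the successor from the index to the start, to match the smaller staircase from
  -- `(suc x , suc y)`.
  rewrite sym (+-suc i x) | sym (+-suc i y) =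
  there (there (stair-edgeInRow (suc x) (suc y) k i i≤k))

-- Mixing the column of the start with the row of the end puts horizontal and
-- vertical edges of the staircase on the same diagonal.
stair-diagonal : ∀ x y k → Consecutive p q (stair x y k) → col p + y ≡ x + row q
stair-diagonal x y zero    here              = refl
stair-diagonal x y zero    (there (there ()))
stair-diagonal x y (suc k) here              = refl
stair-diagonal x y (suc k) (there here)      = sym (+-suc x y)
stair-diagonal {p = p} x y (suc k) (there (there c)) =
  suc-injective (trans (sym (+-suc (col p) y)) (stair-diagonal (suc x) (suc y) k c))

module _ (k n : ℕ) where

  grid : Grid
  -- Staircase `j` ends in column `j + suc k`, and `j ≤ n` keeps this inside. The two outer
  -- successors make every row list unfold to at least two points.
  grid = record { columns = suc (suc k + n) ; rows = suc k }

  rowPath : Fin (suc k) → Path grid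
  rowPath i = record
    { points     = rowPoints (toℕ i) (Grid.columns grid)
    ; inGrid     = applyUpTo⁺₁ _ _ (λ c< → c< , toℕ<n i)
    ; connected  = Linked.map Sym.fwd (rowPoints-ascending _ _)
    ; simple     = ascending⇒unique (rowPoints-ascending _ _)
    ; nontrivial = s≤s (s≤s z≤n)
    }

  stairPath : Fin n → Path grid
  stairPath j = record
    { points     = stair (toℕ j) 0 k
    ; inGrid     = stair-onGrid (toℕ j) 0 k
        (s≤s (subst (toℕ j + suc k ≤_) (+-comm n (suc k))
          (+-monoˡ-≤ (suc k) (<⇒≤ (toℕ<n j)))))
        (n<1+n k)
    ; connected  = Linked.map Sym.fwd (stair-ascending _ _ _)
    ; simple     = ascending⇒unique (stair-ascending _ _ _)
    ; nontrivial = stair-nontrivial _ _ k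
    }

  rowPath-injective : ∀ i i′ → ShareEdge (rowPath i) (rowPath i′) → i ≡ i′
  rowPath-injective i i′ s
    with _ , _ , c , d ← shareEdge⇒consecutive (rowPath i) (rowPath i′)
           (rowPoints-ascending _ _) (rowPoints-ascending _ _) s
    with e , _ ← consecutive⇒All (rowPoints-row (toℕ i) _) c
       | e′ , _ ← consecutive⇒All (rowPoints-row (toℕ i′) _) d =
    toℕ-injective (trans (sym e) e′)

  -- Applied to the same oriented edge from `p` to `q`, `stair-diagonal` equates both
  -- `toℕ j + row q` and `toℕ j′ + row q` with `col p + 0`.
  stairPath-injective : ∀ j j′ → ShareEdge (stairPath j) (stairPath j′) → j ≡ j′
  stairPath-injective j j′ s
    with _ , q , c , d ← shareEdge⇒consecutive (stairPath j) (stairPath j′)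
           (stair-ascending _ _ _) (stair-ascending _ _ _) s =
    toℕ-injective (+-cancelʳ-≡ (row q) _ _
      (trans (sym (stair-diagonal _ _ k c)) (stair-diagonal _ _ k d)))

  row-stair-share : ∀ i j → ShareEdge (rowPath i) (stairPath j)
  row-stair-share i j =
    -- Starting in column `b`, the staircase has moved `a` columns right on reaching row `a`, where
    -- its horizontal edge begins.
    (a + b , a) , (suc (a + b) , a) ,
    inj₁ (consecutive-applyUpTo {f = _, a} (a + b) _ (s≤s (+-mono-≤ (toℕ<n i) (<⇒≤ (toℕ<n j))))) ,
    -- The staircase starts in row 0, so its edge comes with row `a + 0`.
    inj₁ (subst (λ y → Consecutive (a + b , y) (suc (a + b) , y) (stair b 0 k))
           (+-identityʳ a) (stair-edgeInRow b 0 k a (≤-pred (toℕ<n i))))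
    where
    a = toℕ i
    b = toℕ j

  shareEdge-sym : (P Q : Path grid) → ShareEdge P Q → ShareEdge Q P
  shareEdge-sym _ _ (p , q , e , e′) = p , q , e′ , e

  representation : EPGRepresentation (K (suc k) n)
  representation = record
    { grid       = grid
    ; path       = path
    ; represents = λ {v} {w} → represents v w
    }
    where
    path : Vertex (K (suc k) n) → Path grid
    path (inj₁ i) = rowPath i
    path (inj₂ j) = stairPath j

    represents : ∀ v w → v ≢ w → KAdj v w ⇔ ShareEdge (path v) (path w)
    represents (inj₁ i) (inj₁ i′) v≢w =
      mk⇔ (λ ()) (λ s → v≢w (cong inj₁ (rowPath-injective i i′ s)))
    represents (inj₁ i) (inj₂ j)  _   = mk⇔ (λ _ → row-stair-share i j) (λ _ → tt)
    represents (inj₂ j) (inj₁ i)  _   =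
      mk⇔ (λ _ → shareEdge-sym (rowPath i) (stairPath j) (row-stair-share i j)) (λ _ → tt)
    represents (inj₂ j) (inj₂ j′) v≢w =
      mk⇔ (λ ()) (λ s → v≢w (cong inj₂ (stairPath-injective j j′ s)))

theorem2p7 : (m n : ℕ) → 1 ≤ m → m ≤ n → K m n ∈ Bᵐ (2 * m ∸ 2)
theorem2p7 (suc k) n _ _ = representation k n , λ where
  (inj₁ i) → inj₁ (rowPoints-ascending _ _) ,
             ≤-trans (≤-reflexive (bendsOf-inRow (rowPoints (toℕ i) (suc (suc k + n))) (rowPoints-row (toℕ i) _))) z≤n
  (inj₂ j) → inj₁ (stair-ascending _ _ _) ,
             -- With `m = suc k`, the bound `2 * k` is `(2 + 2 * k) ∸ 2` by computation, hence
             -- `2 * m ∸ 2`.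
             subst (bendsOf (stair (toℕ j) 0 k) ≤_) (cong (_∸ 2) (sym (*-suc 2 k)))
               (stair-bends (toℕ j) 0 k)
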